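{- The edge generating series of the Grand Dyck lattices is $$\sum_{n\ge0}\ell(\mathcal{GD}_n)x^n=\frac{x}{(1-4x)^{3/2}},$$ and for every $n\ge0$, $\ell(\mathcal{GD}_n)=\binom{2n}{n}\frac n2$. Consequently $i(\mathcal{GD}_n)=n/2$ for all $n$.
   Context: Steps: $U=(1,1)$, $D=(1,-1)$. $\mathcal{GD}_n$ is the set of all lattice paths from $(0,0)$ to $(2n,0)$ with steps $U,D$, partially ordered by $\gamma_1\le\gamma_2$ iff $\gamma_1$ lies weakly below $\gamma_2$. For a finite poset $P$, $\ell(P)$ is the number of edges of its Hasse diagram (number of covering pairs) and $i(P)=\ell(P)/|P|$. -}

module Defs where

open import Level as Level using (_⊔_; 0ℓ)
open import Data.Nat.Base as ℕ using (ℕ; zero; suc; _∸_)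
open import Data.Integer.Base as ℤ using (ℤ; +_; 0ℤ; 1ℤ; -1ℤ)
import Data.Integer.Properties as ℤ
open import Data.Rational.Base as ℚ using (ℚ; 0ℚ; 1ℚ)
open import Data.Fin.Base using (Fin; zero; suc; fromℕ)
import Data.Fin.Properties as Fin
open import Data.Vec.Base using (Vec; []; _∷_; _++_; replicate)
open import Data.Vec.Properties using (≡-dec; ∷-injective)
open import Data.List.Base using (List; []; _∷_; length; filter; cartesianProduct; cartesianProductWith)
open import Data.List.Membership.Propositional using (_∈_)
open import Data.List.Membership.Propositional.Properties using (∈-cartesianProductWith⁺; ∈-filter⁺)
open import Data.List.Relation.Unary.All using (All; []; _∷_; toList)
open import Data.List.Relation.Unary.All.Properties using (all-filter)
open import Data.List.Relation.Unary.AllPairs using ([]; _∷_)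
open import Data.List.Relation.Unary.Any as Any using (Any; here; there; any?)
open import Data.List.Relation.Unary.Unique.Propositional using () renaming (Unique to Unique≡)
import Data.List.Relation.Unary.Unique.Propositional.Properties as Unique≡
import Data.List.Relation.Unary.Unique.Setoid as UniqueSetoid
import Data.List.Relation.Unary.Enumerates.Setoid as EnumeratesSetoid
open import Data.Product.Base using (Σ-syntax; ∃-syntax; _×_; _,_; proj₁; proj₂)
open import Function.Base using (_∘_)
open import Relation.Binary.Bundles using (DecPoset)
open import Relation.Binary.Definitions using (DecidableEquality; Decidable)
import Relation.Binary.Construct.NonStrictToStrict as ToStrict
open import Relation.Binary.PropositionalEquality
  using (_≡_; _≢_; refl; sym; trans; cong; isEquivalence; module ≡-Reasoning)
open import Relation.Nullary.Decidable using (yes; no; map′; ¬?; _×-dec_)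
open import Algebra.Properties.AbelianGroup ℤ.+-0-abelianGroup using (∙-cancelˡ)
open import Axiom.UniquenessOfIdentityProofs using (module Decidable⇒UIP)
open import Relation.Nullary.Negation using (¬_)
open import Relation.Unary using () renaming (Decidable to Decidable₁)

record FinitePoset c ℓ₁ ℓ₂ : Set (Level.suc (c ⊔ ℓ₁ ⊔ ℓ₂)) where
  field
    decPoset : DecPoset c ℓ₁ ℓ₂

  open DecPoset decPoset public
  open UniqueSetoid Eq.setoid using (Unique)
  open EnumeratesSetoid Eq.setoid using (IsEnumeration)

  field
    elements   : List Carrier
    enumerates : IsEnumeration elements
    unique     : Unique elements

  open ToStrict _≈_ _≤_ public using (_<_)

  infix 4 _⋖_

  _⋖_ : Carrier → Carrier → Set (c ⊔ ℓ₁ ⊔ ℓ₂)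
  x ⋖ y = x < y × ¬ (∃[ z ] (x < z × z < y))

  _<?_ : Decidable _<_
  _<?_ = ToStrict.<-decidable _≈_ _≤_ _≟_ _≤?_

  _⋖?_ : Decidable _⋖_
  x ⋖? y = (x <? y) ×-dec ¬? (map′ Any.satisfied toAny
                                (any? (λ z → (x <? z) ×-dec (z <? y)) elements))
    where
    toAny : ∃[ z ] (x < z × z < y) → Any (λ z → x < z × z < y) elements
    toAny (z , x<z , z<y) = Any.map (λ z≈w → between z≈w) (enumerates z)
      where
      between : ∀ {w} → z ≈ w → x < w × w < y
      between z≈w =
          ToStrict.<-respʳ-≈ _≈_ _≤_ Eq.sym Eq.trans ≤-respʳ-≈ z≈w x<z
        , ToStrict.<-respˡ-≈ _≈_ _≤_ Eq.trans ≤-respˡ-≈ z≈w z<y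

  size : ℕ
  size = length elements

open FinitePoset using (size)

ℓ : ∀ {c ℓ₁ ℓ₂} → FinitePoset c ℓ₁ ℓ₂ → ℕ
ℓ P = length (filter (λ (x , y) → x ⋖? y) (cartesianProduct elements elements))
  where open FinitePoset P

i : ∀ {c ℓ₁ ℓ₂} (P : FinitePoset c ℓ₁ ℓ₂) → .{{ℕ.NonZero (size P)}} → ℚ
i P = + ℓ P ℚ./ size P

data Step : Set where
  U D : Step

rise : Step → ℤ
rise U = 1ℤ
rise D = -1ℤ

-- Each step advances the abscissa by one, so a path of m steps from (0,0)
-- passes through the points (k , heightAt γ k) for 0 ≤ k ≤ m.
heightAt : ∀ {m} → Vec Step m → Fin (suc m) → ℤ
heightAt _       zero    = 0ℤ
heightAt (s ∷ γ) (suc k) = rise s ℤ.+ heightAt γ k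

ReturnsTo0 : ∀ {m} → Vec Step m → Set
ReturnsTo0 {m} γ = heightAt γ (fromℕ m) ≡ 0ℤ

PathTo0 : ℕ → Set
PathTo0 m = Σ[ γ ∈ Vec Step m ] ReturnsTo0 γ

GrandDyckPath : ℕ → Set
GrandDyckPath n = PathTo0 (2 ℕ.* n)

-- Paths are linear between consecutive integer abscissae, so "weakly below"
-- need only be tested at the integer ones.
WeaklyBelow : ∀ {m} → PathTo0 m → PathTo0 m → Set
WeaklyBelow (γ₁ , _) (γ₂ , _) = ∀ k → heightAt γ₁ k ℤ.≤ heightAt γ₂ k

_≟ˢ_ : DecidableEquality Step
U ≟ˢ U = yes refl
U ≟ˢ D = no λ ()
D ≟ˢ U = no λ ()
D ≟ˢ D = yes refl

ℤ-≡-irrelevant : ∀ {a b : ℤ} (p q : a ≡ b) → p ≡ q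
ℤ-≡-irrelevant = Decidable⇒UIP.≡-irrelevant ℤ._≟_

path-≡ : ∀ {m} {γ₁ γ₂ : PathTo0 m} → proj₁ γ₁ ≡ proj₁ γ₂ → γ₁ ≡ γ₂
path-≡ {γ₁ = γ , p} {γ₂ = _ , q} refl = cong (γ ,_) (ℤ-≡-irrelevant p q)

heightAt-injective : ∀ {m} (γ₁ γ₂ : Vec Step m) →
                     (∀ k → heightAt γ₁ k ≡ heightAt γ₂ k) → γ₁ ≡ γ₂
heightAt-injective []       []       _  = refl
heightAt-injective (s ∷ γ₁) (t ∷ γ₂) eq with sameStep s t (eq (suc zero))
  where
  sameStep : ∀ s t → rise s ℤ.+ 0ℤ ≡ rise t ℤ.+ 0ℤ → s ≡ t
  sameStep U U _ = refl
  sameStep D D _ = refl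
... | refl = cong (s ∷_) (heightAt-injective γ₁ γ₂ λ k →
               ∙-cancelˡ (rise s) (heightAt γ₁ k) (heightAt γ₂ k) (eq (suc k)))

GDDecPoset : ℕ → DecPoset 0ℓ 0ℓ 0ℓ
GDDecPoset n = record
  { Carrier = GrandDyckPath n
  ; _≈_     = _≡_
  ; _≤_     = WeaklyBelow
  ; isDecPartialOrder = record
    { isPartialOrder = record
      { isPreorder = record
        { isEquivalence = isEquivalence
        ; reflexive     = λ where refl k → ℤ.≤-refl
        ; trans         = λ p q k → ℤ.≤-trans (p k) (q k)
        }
      ; antisym = λ {γ₁} {γ₂} p q → path-≡
          (heightAt-injective (proj₁ γ₁) (proj₁ γ₂) λ k → ℤ.≤-antisym (p k) (q k))
      }
    ; _≟_  = λ γ₁ γ₂ → map′ path-≡ (cong proj₁) (≡-dec _≟ˢ_ (proj₁ γ₁) (proj₁ γ₂))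
    ; _≤?_ = λ γ₁ γ₂ → Fin.all? λ k → heightAt (proj₁ γ₁) k ℤ.≤? heightAt (proj₁ γ₂) k
    }
  }

stepSequences : ∀ m → List (Vec Step m)
stepSequences zero    = [] ∷ []
stepSequences (suc m) = cartesianProductWith _∷_ (U ∷ D ∷ []) (stepSequences m)

stepSequences-complete : ∀ {m} (γ : Vec Step m) → γ ∈ stepSequences m
stepSequences-complete []      = here refl
stepSequences-complete (s ∷ γ) =
  ∈-cartesianProductWith⁺ _∷_ (step∈ s) (stepSequences-complete γ)
  where
  step∈ : ∀ s → s ∈ U ∷ D ∷ []
  step∈ U = here refl
  step∈ D = there (here refl)

stepSequences-unique : ∀ m → Unique≡ (stepSequences m)
stepSequences-unique zero    = [] ∷ []
stepSequences-unique (suc m) =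
  Unique≡.cartesianProductWith⁺ _∷_ ∷-injective
    (((λ ()) ∷ []) ∷ [] ∷ []) (stepSequences-unique m)

returnsTo0? : ∀ {m} → Decidable₁ (ReturnsTo0 {m})
returnsTo0? {m} γ = heightAt γ (fromℕ m) ℤ.≟ 0ℤ

grandDyckPaths : ∀ n → List (GrandDyckPath n)
grandDyckPaths n = toList (all-filter returnsTo0? (stepSequences (2 ℕ.* n)))

module _ {m : ℕ} where

  ∈-toList : ∀ {γs} (all : All (ReturnsTo0 {m}) γs) (γ : PathTo0 m) →
             proj₁ γ ∈ γs → γ ∈ toList all
  ∈-toList (p ∷ ps) γ (here eq) = here (path-≡ eq)
  ∈-toList (p ∷ ps) γ (there m) = there (∈-toList ps γ m)

  toList-unique : ∀ {γs} (all : All (ReturnsTo0 {m}) γs) →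
                  Unique≡ γs → Unique≡ (toList all)
  toList-unique []       []       = []
  toList-unique (p ∷ ps) (x ∷ xs) = fresh ps x ∷ toList-unique ps xs
    where
    fresh : ∀ {γ p γs} (all : All (ReturnsTo0 {m}) γs) →
            All (γ ≢_) γs → All ((γ , p) ≢_) (toList all)
    fresh []       []       = []
    fresh (_ ∷ qs) (x ∷ xs) = (x ∘ cong proj₁) ∷ fresh qs xs

grandDyckPaths-complete : ∀ n (γ : GrandDyckPath n) → γ ∈ grandDyckPaths n
grandDyckPaths-complete n γ = ∈-toList (all-filter returnsTo0? (stepSequences (2 ℕ.* n))) γ
  (∈-filter⁺ returnsTo0? (stepSequences-complete (proj₁ γ)) (proj₂ γ))

GD : ℕ → FinitePoset 0ℓ 0ℓ 0ℓ
GD n = record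
  { decPoset   = GDDecPoset n
  ; elements   = grandDyckPaths n
  ; enumerates = grandDyckPaths-complete n
  ; unique     = toList-unique (all-filter returnsTo0? (stepSequences (2 ℕ.* n)))
                   (Unique≡.filter⁺ returnsTo0? (stepSequences-unique (2 ℕ.* n)))
  }

peak : ∀ n → GrandDyckPath n
peak n = replicate n U ++ (replicate n D ++ []) , (begin
  heightAt (replicate n U ++ (replicate n D ++ [])) (fromℕ (2 ℕ.* n))
    ≡⟨ up n (replicate n D ++ []) ⟩
  + n ℤ.+ heightAt (replicate n D ++ []) (fromℕ (n ℕ.+ 0))
    ≡⟨ cong (λ h → + n ℤ.+ h) (down n) ⟩
  + n ℤ.+ ℤ.- (+ n)
    ≡⟨ ℤ.+-inverseʳ (+ n) ⟩
  0ℤ ∎)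
  where
  open ≡-Reasoning

  up : ∀ k {m} (γ : Vec Step m) →
       heightAt (replicate k U ++ γ) (fromℕ (k ℕ.+ m)) ≡ + k ℤ.+ heightAt γ (fromℕ m)
  up zero    {m} γ = sym (ℤ.+-identityˡ _)
  up (suc k) {m} γ = trans (cong (λ h → 1ℤ ℤ.+ h) (up k γ))
                           (sym (ℤ.+-assoc 1ℤ (+ k) (heightAt γ (fromℕ m))))

  down : ∀ k → heightAt (replicate k D ++ []) (fromℕ (k ℕ.+ 0)) ≡ ℤ.- (+ k)
  down zero    = refl
  down (suc k) = trans (cong (λ h → -1ℤ ℤ.+ h) (down k))
                       (sym (ℤ.neg-distrib-+ 1ℤ (+ k)))

GD-nonEmpty : ∀ n → ℕ.NonZero (size (GD n))
GD-nonEmpty n = nonEmpty (grandDyckPaths-complete n (peak n))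
  where
  nonEmpty : ∀ {A : Set} {x : A} {xs} → x ∈ xs → ℕ.NonZero (length xs)
  nonEmpty (here _)  = _
  nonEmpty (there _) = _

-- f n is the coefficient of xⁿ.
Series : Set
Series = ℕ → ℚ

infix 4 _≗ₛ_

_≗ₛ_ : Series → Series → Set
f ≗ₛ g = ∀ n → f n ≡ g n

sumUpTo : (ℕ → ℚ) → ℕ → ℚ
sumUpTo f zero    = f zero
sumUpTo f (suc n) = sumUpTo f n ℚ.+ f (suc n)

infixl 6 _-ₛ_
infixl 7 _•_ _*ₛ_ _÷ₛ_
infixr 8 _^ₛ_

1ₛ : Series
1ₛ zero    = 1ℚ
1ₛ (suc _) = 0ℚ

X : Series
X zero    = 0ℚ
X (suc n) = 1ₛ n

_-ₛ_ : Series → Series → Series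
(f -ₛ g) n = f n ℚ.- g n

_•_ : ℚ → Series → Series
(c • f) n = c ℚ.* f n

_*ₛ_ : Series → Series → Series
(f *ₛ g) n = sumUpTo (λ k → f k ℚ.* g (n ∸ k)) n

_^ₛ_ : Series → ℕ → Series
f ^ₛ zero  = 1ₛ
f ^ₛ suc k = f *ₛ (f ^ₛ k)

-- Long division: writing q = f₀ / g₀, the series f - q g has no constant
-- term, and f / g = q + x (((f - q g) / x) / g).
_÷ₛ_ : (f g : Series) → .{{ℚ.NonZero (g 0)}} → Series
(f ÷ₛ g) zero    = f 0 ℚ.÷ g 0
(f ÷ₛ g) (suc n) = ((λ m → (f -ₛ (f 0 ℚ.÷ g 0) • g) (suc m)) ÷ₛ g) n

-- α (α - 1) ⋯ (α - k + 1) / k!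
binomial : ℚ → ℕ → ℚ
binomial α zero    = 1ℚ
binomial α (suc k) = binomial α k ℚ.* (α ℚ.- + k ℚ./ 1) ℚ.* (+ 1 ℚ./ suc k)

-- f ^ α = Σₖ binomial α k (f - 1)ᵏ for a series f with constant term 1.  As
-- (f - 1)ᵏ is divisible by xᵏ, only k ≤ n contribute to the coefficient of xⁿ.
power : (f : Series) → .(f 0 ≡ 1ℚ) → ℚ → Series
power f _ α n = sumUpTo (λ k → binomial α k ℚ.* ((f -ₛ 1ₛ) ^ₛ k) n) n

-- One path covers another exactly when it arises from it by flipping a single valley
-- DU to a peak UD: below a strictly larger path with the same end there is always a
-- valley with room to be flipped.  Covers in the n-th lattice thus correspond to words
-- with n - 1 steps of each kind and one of 2n - 1 insertion points, giving
-- (2n - 1) C(2n - 2 , n - 1) = C(2n , n) n / 2 of them.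
--
-- For the generating series, let T = Σ ℓ(n + 1) xⁿ and P = (1 - 4x)^(3/2).  Their
-- coefficient recurrences say (1 - 4x) T′ = 6 T and (1 - 4x) P′ = -6 P, so T P has
-- derivative zero and hence equals 1.

module Submission where

open import Defs
open import Data.Nat using (ℕ; _*_)
open import Data.Nat.Combinatorics using (_C_)
open import Data.Integer using (+_)
open import Data.Rational as ℚ using (ℚ; _/_)
open import Data.Product using (_×_)
open import Relation.Binary.PropositionalEquality using (_≡_; refl)

open import Algebra.Properties.AbelianGroup using (∙-cancelˡ; ∙-cancelʳ)
open import Data.Bool using (true; false)
open import Data.Fin using (zero; suc; fromℕ)
open import Data.Integer as ℤ using (ℤ; -[1+_]; +≤+)
import Data.Integer.Properties as ℤ
import Data.Integer.Tactic.RingSolver as ℤ-Solver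
open import Data.List using (List; []; _∷_; _++_; map; filter; length; cartesianProduct)
open import Data.List.Membership.Propositional using (_∈_)
open import Data.List.Membership.Propositional.Properties
  using (∈-map⁺; ∈-map⁻; ∈-++⁺ˡ; ∈-++⁺ʳ; ∈-++⁻; ∈-filter⁺; ∈-filter⁻; ∈-cartesianProduct⁺)
open import Data.List.Membership.Propositional.Properties.WithK using (unique∧set⇒bag)
open import Data.List.Properties
  using (length-map; length-++; filter-++; filter-none; filter-≐; ++-identityʳ)
open import Data.List.Relation.Binary.BagAndSetEquality using (∼bag⇒↭)
open import Data.List.Relation.Binary.Permutation.Propositional.Properties using (↭-length)
open import Data.List.Relation.Unary.All as All using (All; []; _∷_; toList)
import Data.List.Relation.Unary.All.Properties as All
open import Data.List.Relation.Unary.Unique.Propositional using (Unique; [])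
import Data.List.Relation.Unary.Unique.Propositional.Properties as Unique
open import Data.Nat using (zero; suc; _+_; _∸_; _≤_; _≟_; NonZero; z≤n)
open import Data.Nat.Combinatorics using (nCk+nC[k+1]≡[n+1]C[k+1]; nC1≡n; nCk≡nC[n∸k])
import Data.Nat.Properties as ℕ
open import Data.Nat.Tactic.RingSolver using (solve-∀)
open import Data.Product using (_,_; proj₁; proj₂; ∃-syntax)
open import Data.Rational using (0ℚ; 1ℚ)
import Data.Rational.Properties as ℚ
open import Data.Rational.Solver using (module +-*-Solver)
open import Data.Rational.Unnormalised as ℚᵘ using (mkℚᵘ)
import Data.Rational.Unnormalised.Properties as ℚᵘ
open import Data.Sum using (_⊎_; inj₁; inj₂)
open import Data.Vec using (Vec; []; _∷_)
import Data.Vec.Properties as Vec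
open import Function using (_∘_; _⇔_; mk⇔; Equivalence)
open import Function.Construct.Identity using (⇔-id)
open import Relation.Binary.PropositionalEquality
  using (_≢_; sym; trans; cong; cong₂; subst; subst₂; module ≡-Reasoning)
open import Relation.Nullary using (¬_; does; yes; no; contradiction)
open import Relation.Unary using (Decidable)
open +-*-Solver using (solve; _:+_; _:*_; _:-_; _:=_; con)

private variable
  l m n g : ℕ
  s t : Step
  γ δ ζ : Vec Step m

-- Comparison of step words and valley flips

infix 4 _≼[_]_ _↗_

-- γ ≼[ g ] δ: shifted up by 2g, the path δ lies weakly above γ and ends where γ does.
data _≼[_]_ : Vec Step m → ℕ → Vec Step m → Set where
  []    : [] ≼[ 0 ] []
  same  : γ ≼[ g ] δ → s ∷ γ ≼[ g ] s ∷ δ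
  apart : γ ≼[ suc g ] δ → D ∷ γ ≼[ g ] U ∷ δ
  close : γ ≼[ g ] δ → U ∷ γ ≼[ suc g ] D ∷ δ

-- Defined on all words, with no condition on the end height, so that inductions can strip first
-- steps.
data _↗_ : Vec Step m → Vec Step m → Set where
  flip : D ∷ U ∷ γ ↗ U ∷ D ∷ γ
  keep : γ ↗ δ → s ∷ γ ↗ s ∷ δ

≼-refl : γ ≼[ 0 ] γ
≼-refl {γ = []}    = []
≼-refl {γ = s ∷ γ} = same ≼-refl

≼-antisym : γ ≼[ 0 ] δ → δ ≼[ 0 ] γ → γ ≡ δ
≼-antisym []       []       = refl
≼-antisym (same p) (same q) = cong (_ ∷_) (≼-antisym p q)

↗⇒≼ : γ ↗ δ → γ ≼[ 0 ] δ
↗⇒≼ flip     = apart (close ≼-refl)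
↗⇒≼ (keep c) = same (↗⇒≼ c)

↗⇒≢ : γ ↗ δ → γ ≢ δ
↗⇒≢ (keep c) refl = ↗⇒≢ c refl

-- A flip changes the height of one vertex only, by 2, and parity leaves no third height there. At
-- all other vertices `ζ` is squeezed between equal heights.
↗-tight : γ ↗ δ → γ ≼[ 0 ] ζ → ζ ≼[ 0 ] δ → ζ ≡ γ ⊎ ζ ≡ δ
↗-tight flip     (same (same p))   (apart (close q)) = inj₁ (cong (λ γ → D ∷ U ∷ γ) (≼-antisym q p))
↗-tight flip     (apart (close p)) (same (same q))   = inj₂ (cong (λ γ → U ∷ D ∷ γ) (≼-antisym q p))
-- Here `ζ` begins with two up-steps, but `δ` begins `U ∷ D`, and at gap 0 no up-step can lie below
-- a down-step.
↗-tight flip     (apart (same p))  (same ())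
↗-tight (keep c) (same p)          (same q)          with ↗-tight c p q
... | inj₁ eq = inj₁ (cong (_ ∷_) eq)
... | inj₂ eq = inj₂ (cong (_ ∷_) eq)

-- The valley ending the initial run of down-steps of D ∷ γ has room to be flipped.
flip-first-valley : γ ≼[ suc g ] δ →
  ∃[ ζ ] (D ∷ γ ↗ ζ × ζ ≼[ g ] U ∷ δ × ζ ≼[ suc g ] D ∷ δ)
flip-first-valley (same {s = U} p) = _ , flip , same (apart p) , close (apart p)
flip-first-valley (close p)        = _ , flip , same (same p) , close (same p)
-- Two bounds on `ζ` are carried because the next step of the upper path decides which one is
-- needed: the bound by `D ∷ δ` if it falls, as here, and the bound by `U ∷ δ` if it rises.
flip-first-valley (same {s = D} p) with flip-first-valley p
... | _ , c , _ , q = _ , keep c , apart q , same q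
flip-first-valley (apart p)        with flip-first-valley p
... | _ , c , q , _ = _ , keep c , apart q , same q

-- Common steps are stripped until the paths separate. There the lower one falls and the upper one
-- rises, so the next valley of the lower path can be flipped.
↗-exists : γ ≼[ 0 ] δ → γ ≢ δ → ∃[ ζ ] (γ ↗ ζ × ζ ≼[ 0 ] δ)
↗-exists []        γ≢δ = contradiction refl γ≢δ
↗-exists (same p)  γ≢δ with ↗-exists p (γ≢δ ∘ cong (_ ∷_))
... | _ , c , q = _ , keep c , same q
↗-exists (apart p) γ≢δ with flip-first-valley p
... | _ , c , q , _ = _ , c , q

-- Heights of lattice paths

-- The hypothesis relates the gap `g` before the steps `s` (below) and `t` (above) to the gap `g′`
-- after them. Each of `same`, `apart` and `close` satisfies it, so both translations between `≼`
-- and heights share this rearrangement.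
gap-exchange : ∀ g g′ s t b → + (g′ + g′) ℤ.+ rise s ≡ + (g + g) ℤ.+ rise t →
  + (g + g) ℤ.+ (rise t ℤ.+ b) ≡ rise s ℤ.+ (+ (g′ + g′) ℤ.+ b)
gap-exchange g g′ s t b eq = begin
  + (g + g) ℤ.+ (rise t ℤ.+ b)    ≡⟨ ℤ.+-assoc (+ (g + g)) (rise t) b ⟨
  + (g + g) ℤ.+ rise t ℤ.+ b      ≡⟨ cong (ℤ._+ b) eq ⟨
  + (g′ + g′) ℤ.+ rise s ℤ.+ b    ≡⟨ cong (ℤ._+ b) (ℤ.+-comm (+ (g′ + g′)) (rise s)) ⟩
  rise s ℤ.+ + (g′ + g′) ℤ.+ b    ≡⟨ ℤ.+-assoc (rise s) (+ (g′ + g′)) b ⟩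
  rise s ℤ.+ (+ (g′ + g′) ℤ.+ b)  ∎
  where open ≡-Reasoning

gap-apart : ∀ g → + (suc g + suc g) ℤ.+ rise D ≡ + (g + g) ℤ.+ rise U
gap-apart g = begin
  + (suc g + suc g) ℤ.+ rise D        ≡⟨ cong (λ h → + suc h ℤ.+ rise D) (ℕ.+-suc g g) ⟩
  + (2 + (g + g)) ℤ.+ rise D          ≡⟨⟩
  (+ 2 ℤ.+ + (g + g)) ℤ.+ rise D      ≡⟨ lemma (+ (g + g)) ⟩
  + (g + g) ℤ.+ rise U                ∎
  where
  open ≡-Reasoning
  lemma : ∀ x → (+ 2 ℤ.+ x) ℤ.+ rise D ≡ x ℤ.+ rise U
  lemma = ℤ-Solver.solve-∀

≼⇒below : γ ≼[ g ] δ → ∀ k → heightAt γ k ℤ.≤ + (g + g) ℤ.+ heightAt δ k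
≼⇒below-tail : ∀ g g′ s t {γ δ : Vec Step m} → + (g′ + g′) ℤ.+ rise s ≡ + (g + g) ℤ.+ rise t →
  γ ≼[ g′ ] δ → ∀ k → rise s ℤ.+ heightAt γ k ℤ.≤ + (g + g) ℤ.+ (rise t ℤ.+ heightAt δ k)

≼⇒below _                           zero    = +≤+ z≤n
≼⇒below (same {g = g} {s = s} p)    (suc k) = ≼⇒below-tail g g s s refl p k
≼⇒below (apart {g = g} p)           (suc k) = ≼⇒below-tail g (suc g) D U (gap-apart g) p k
≼⇒below (close {g = g} p)           (suc k) = ≼⇒below-tail (suc g) g U D (sym (gap-apart g)) p k

≼⇒below-tail g g′ s t eq p k = subst (_ ℤ.≤_) (sym (gap-exchange g g′ s t _ eq))
  (ℤ.+-monoʳ-≤ (rise s) (≼⇒below p k))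

+-cancelˡ-≤ : ∀ r {a b} → r ℤ.+ a ℤ.≤ r ℤ.+ b → a ℤ.≤ b
+-cancelˡ-≤ r {a} {b} p = subst₂ ℤ._≤_ (lemma r a) (lemma r b) (ℤ.+-monoʳ-≤ (ℤ.- r) p)
  where
  lemma : ∀ r a → ℤ.- r ℤ.+ (r ℤ.+ a) ≡ a
  lemma = ℤ-Solver.solve-∀

-- The bounds exclude an up-step below a down-step at gap 0; the equality of the end heights makes
-- the gap 0 when the words run out.
below⇒≼ : ∀ g (γ δ : Vec Step m) →
  (∀ k → heightAt γ k ℤ.≤ + (g + g) ℤ.+ heightAt δ k) →
  heightAt γ (fromℕ m) ≡ + (g + g) ℤ.+ heightAt δ (fromℕ m) → γ ≼[ g ] δ
below⇒≼-tail : ∀ g g′ s t (γ δ : Vec Step m) →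
  + (g′ + g′) ℤ.+ rise s ≡ + (g + g) ℤ.+ rise t →
  (∀ k → heightAt (s ∷ γ) k ℤ.≤ + (g + g) ℤ.+ heightAt (t ∷ δ) k) →
  heightAt (s ∷ γ) (fromℕ (suc m)) ≡ + (g + g) ℤ.+ heightAt (t ∷ δ) (fromℕ (suc m)) → γ ≼[ g′ ] δ

below⇒≼ zero    []      []      p e = []
below⇒≼ (suc g) []      []      p ()
below⇒≼ g       (U ∷ γ) (U ∷ δ) p e = same (below⇒≼-tail g g U U γ δ refl p e)
below⇒≼ g       (D ∷ γ) (D ∷ δ) p e = same (below⇒≼-tail g g D D γ δ refl p e)
below⇒≼ g       (D ∷ γ) (U ∷ δ) p e = apart (below⇒≼-tail g (suc g) D U γ δ (gap-apart g) p e)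
below⇒≼ (suc g) (U ∷ γ) (D ∷ δ) p e = close (below⇒≼-tail (suc g) g U D γ δ (sym (gap-apart g)) p e)
below⇒≼ zero    (U ∷ γ) (D ∷ δ) p e with p (suc zero)
... | ()

below⇒≼-tail g g′ s t γ δ eq p e = below⇒≼ g′ γ δ
  (λ k → +-cancelˡ-≤ (rise s)
    (subst (_ ℤ.≤_) (gap-exchange g g′ s t (heightAt δ k) eq) (p (suc k))))
  (∙-cancelˡ ℤ.+-0-abelianGroup (rise s) _ _ (trans e (gap-exchange g g′ s t (heightAt δ (fromℕ _)) eq)))

ups : Vec Step m → ℕ
ups []      = 0
ups (U ∷ γ) = suc (ups γ)
ups (D ∷ γ) = ups γ

↗-ups : γ ↗ δ → ups γ ≡ ups δ
↗-ups flip             = refl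
↗-ups (keep {s = U} c) = cong suc (↗-ups c)
↗-ups (keep {s = D} c) = ↗-ups c

↗-ups≢0 : γ ↗ δ → ups γ ≢ 0
↗-ups≢0 (keep {s = D} c) eq = ↗-ups≢0 c eq

-- An up-step raises height plus length by 2, a down-step leaves it unchanged.
final-height : (γ : Vec Step m) → heightAt γ (fromℕ m) ℤ.+ + m ≡ + (2 * ups γ)
final-height []                = refl
final-height {suc m} (U ∷ γ) = begin
  + 1 ℤ.+ h ℤ.+ (+ 1 ℤ.+ + m)  ≡⟨ lemma h (+ m) ⟩
  + 2 ℤ.+ (h ℤ.+ + m)          ≡⟨ cong (ℤ._+_ (+ 2)) (final-height γ) ⟩
  + (2 + 2 * ups γ)            ≡⟨ cong +_ (lemma′ (ups γ)) ⟩
  + (2 * suc (ups γ))          ∎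
  where
  open ≡-Reasoning
  h = heightAt γ (fromℕ m)
  lemma : ∀ h m → + 1 ℤ.+ h ℤ.+ (+ 1 ℤ.+ m) ≡ + 2 ℤ.+ (h ℤ.+ m)
  lemma = ℤ-Solver.solve-∀
  lemma′ : ∀ u → 2 + 2 * u ≡ 2 * suc u
  lemma′ = solve-∀
final-height {suc m} (D ∷ γ) = trans (lemma (heightAt γ (fromℕ m)) (+ m)) (final-height γ)
  where
  lemma : ∀ h m → rise D ℤ.+ h ℤ.+ (+ 1 ℤ.+ m) ≡ h ℤ.+ m
  lemma = ℤ-Solver.solve-∀

-- Replaces the return condition by a count that recursion on words can follow.
returns⇔ups : (γ : Vec Step (2 * n)) → ReturnsTo0 γ ⇔ ups γ ≡ n
returns⇔ups {n} γ = mk⇔ to from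
  where
  to : ReturnsTo0 γ → ups γ ≡ n
  to r = sym (ℕ.*-cancelˡ-≡ n (ups γ) 2
    (ℤ.+-injective (trans (cong (ℤ._+ + (2 * n)) (sym r)) (final-height γ))))
  from : ups γ ≡ n → ReturnsTo0 γ
  from u = ∙-cancelʳ ℤ.+-0-abelianGroup (+ (2 * n)) _ _ (trans (final-height γ) (cong (λ k → + (2 * k)) u))

-- Covers in the Grand Dyck lattice as valley flips

≤⇒≼ : (γ δ : PathTo0 m) → WeaklyBelow γ δ → proj₁ γ ≼[ 0 ] proj₁ δ
≤⇒≼ (γ , p) (δ , q) γ≤δ = below⇒≼ 0 γ δ
  (λ k → subst (heightAt γ k ℤ.≤_) (sym (ℤ.+-identityˡ _)) (γ≤δ k))
  (trans p (sym (trans (ℤ.+-identityˡ _) q)))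

≼⇒≤ : (γ δ : PathTo0 m) → proj₁ γ ≼[ 0 ] proj₁ δ → WeaklyBelow γ δ
≼⇒≤ (γ , _) (δ , _) p k = subst (heightAt γ k ℤ.≤_) (ℤ.+-identityˡ _) (≼⇒below p k)

module _ {n : ℕ} where
  open FinitePoset (GD n) using (_⋖_)

  -- Some flip `ζ` of `γ` lies weakly below `δ`. It has as many up-steps as `γ`, so it is again a
  -- Grand Dyck path, and if it differed from `δ` it would lie strictly between.
  ⋖⇒↗ : ∀ {γ δ} → γ ⋖ δ → proj₁ γ ↗ proj₁ δ
  ⋖⇒↗ {γ , γ-returns} {δ , δ-returns} ((γ≤δ , γ≢δ) , tight)
    with ↗-exists (≤⇒≼ (γ , γ-returns) (δ , δ-returns) γ≤δ) (γ≢δ ∘ path-≡)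
  ... | ζ , c , ζ≼δ with Vec.≡-dec _≟ˢ_ ζ δ
  ... | yes refl = c
  ... | no ζ≢δ   = contradiction
    ( (ζ , ζ-returns)
    , (≼⇒≤ (γ , γ-returns) (ζ , ζ-returns) (↗⇒≼ c) , ↗⇒≢ c ∘ cong proj₁)
    , (≼⇒≤ (ζ , ζ-returns) (δ , δ-returns) ζ≼δ , ζ≢δ ∘ cong proj₁)) tight
    where
    ζ-returns = Equivalence.from (returns⇔ups {n} ζ)
      (trans (sym (↗-ups c)) (Equivalence.to (returns⇔ups {n} γ) γ-returns))

  ↗⇒⋖ : ∀ {γ δ : GrandDyckPath n} → proj₁ γ ↗ proj₁ δ → γ ⋖ δ
  ↗⇒⋖ {γ} {δ} c = (≼⇒≤ γ δ (↗⇒≼ c) , ↗⇒≢ c ∘ cong proj₁) , tight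
    where
    tight : ¬ (∃[ ζ ] _)
    tight (ζ , (γ≤ζ , γ≢ζ) , (ζ≤δ , ζ≢δ)) with ↗-tight c (≤⇒≼ γ ζ γ≤ζ) (≤⇒≼ ζ δ ζ≤δ)
    ... | inj₁ ζ≡γ = γ≢ζ (path-≡ (sym ζ≡γ))
    ... | inj₂ ζ≡δ = ζ≢δ (path-≡ ζ≡δ)

-- Counting paths and covers

filter-map : {A B : Set} {P : B → Set} (P? : Decidable P) (h : A → B) (xs : List A) →
             filter P? (map h xs) ≡ map h (filter (P? ∘ h) xs)
filter-map P? h []       = refl
filter-map P? h (x ∷ xs) with does (P? (h x))
... | true  = cong (h x ∷_) (filter-map P? h xs)
... | false = filter-map P? h xs

count : {A : Set} → (A → ℕ) → ℕ → List A → ℕ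
count f k xs = length (filter (λ x → f x ≟ k) xs)

module _ {A : Set} (f : A → ℕ) (k : ℕ) where

  count-++ : ∀ xs ys → count f k (xs ++ ys) ≡ count f k xs + count f k ys
  count-++ xs ys = trans (cong length (filter-++ (λ x → f x ≟ k) xs ys)) (length-++ (filter (λ x → f x ≟ k) xs))

  count-map : {B : Set} (h : B → A) (f′ : B → ℕ) (k′ : ℕ) → (∀ x → f (h x) ≡ k ⇔ f′ x ≡ k′) →
              ∀ xs → count f k (map h xs) ≡ count f′ k′ xs
  count-map h f′ k′ e xs = begin
    length (filter f≟k (map h xs))          ≡⟨ cong length (filter-map f≟k h xs) ⟩
    length (map h (filter (f≟k ∘ h) xs))    ≡⟨ length-map h (filter (f≟k ∘ h) xs) ⟩
    length (filter (f≟k ∘ h) xs)            ≡⟨ cong length (filter-≐ (f≟k ∘ h) (λ x → f′ x ≟ k′)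
                                                 ((λ {x} → Equivalence.to (e x)) , λ {x} → Equivalence.from (e x)) xs) ⟩
    count f′ k′ xs                          ∎
    where
    open ≡-Reasoning
    f≟k = λ x → f x ≟ k

  count-none : ∀ {xs} → All (λ x → f x ≢ k) xs → count f k xs ≡ 0
  count-none fs = cong length (filter-none (λ x → f x ≟ k) fs)

suc-⇔ : ∀ {a b} → suc a ≡ suc b ⇔ a ≡ b
suc-⇔ = mk⇔ ℕ.suc-injective (cong suc)

-- Splitting the words by their first step gives Pascal's rule.
count-stepSequences : ∀ m k → count ups k (stepSequences m) ≡ m C k
count-stepSequences zero    zero    = refl
count-stepSequences zero    (suc k) = refl
count-stepSequences (suc m) k = begin
  count ups k (map (U ∷_) S ++ map (D ∷_) S ++ [])
    ≡⟨ count-++ ups k (map (U ∷_) S) _ ⟩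
  count ups k (map (U ∷_) S) + count ups k (map (D ∷_) S ++ [])
    ≡⟨ cong (λ xs → count ups k (map (U ∷_) S) + count ups k xs) (++-identityʳ (map (D ∷_) S)) ⟩
  count ups k (map (U ∷_) S) + count ups k (map (D ∷_) S)
    ≡⟨ cong (_+_ (count ups k (map (U ∷_) S)))
         (trans (count-map ups k (D ∷_) ups k (λ _ → ⇔-id _) S) (count-stepSequences m k)) ⟩
  count ups k (map (U ∷_) S) + m C k
    ≡⟨ pascal k ⟩
  suc m C k ∎
  where
  open ≡-Reasoning
  S = stepSequences m
  pascal : ∀ k → count ups k (map (U ∷_) S) + m C k ≡ suc m C k
  pascal zero    = cong (_+ (m C 0)) (count-none ups 0 (All.map⁺ (All.universal (λ _ ()) S)))
  pascal (suc k) = trans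
    (cong (_+ (m C suc k)) (trans (count-map ups (suc k) (U ∷_) ups k (λ _ → suc-⇔) S) (count-stepSequences m k)))
    (nCk+nC[k+1]≡[n+1]C[k+1] m k)

-- Enumeration of valley flips

Pair : ℕ → Set
Pair m = Vec Step m × Vec Step m

flipPair : Vec Step m → Pair (2 + m)
flipPair γ = D ∷ U ∷ γ , U ∷ D ∷ γ

keepPair : Step → Pair m → Pair (suc m)
keepPair s (γ , δ) = s ∷ γ , s ∷ δ

-- Lists the flips of words with any end height: the valley is either at the very front or behind a
-- common first step. Fixing the number of up-steps later selects the Grand Dyck paths.
coverPairs : ∀ m → List (Pair m)
coverPairs zero          = []
coverPairs (suc zero)    = []
coverPairs (suc (suc m)) =
  map flipPair (stepSequences m)
    ++ map (keepPair U) (coverPairs (suc m)) ++ map (keepPair D) (coverPairs (suc m))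

coverPairs-complete : γ ↗ δ → (γ , δ) ∈ coverPairs m
coverPairs-complete (flip {γ = γ}) = ∈-++⁺ˡ (∈-map⁺ flipPair (stepSequences-complete γ))
coverPairs-complete {m = suc (suc m)} (keep {s = U} c) =
  ∈-++⁺ʳ (map flipPair (stepSequences m)) (∈-++⁺ˡ (∈-map⁺ (keepPair U) (coverPairs-complete c)))
coverPairs-complete {m = suc (suc m)} (keep {s = D} c) =
  ∈-++⁺ʳ (map flipPair (stepSequences m)) (∈-++⁺ʳ (map (keepPair U) (coverPairs (suc m)))
    (∈-map⁺ (keepPair D) (coverPairs-complete c)))

coverPairs-sound : ∀ m → All (λ (γ , δ) → γ ↗ δ) (coverPairs m)
coverPairs-sound zero          = []
coverPairs-sound (suc zero)    = []
coverPairs-sound (suc (suc m)) =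
  All.++⁺ (All.map⁺ (All.universal (λ _ → flip) (stepSequences m)))
    (All.++⁺ (All.map⁺ (All.map keep (coverPairs-sound (suc m))))
             (All.map⁺ (All.map keep (coverPairs-sound (suc m)))))

-- First steps tell the three blocks apart: they differ in a front flip, and are both `U` or both
-- `D` in the others.
coverPairs-unique : ∀ m → Unique (coverPairs m)
coverPairs-unique zero          = []
coverPairs-unique (suc zero)    = []
coverPairs-unique (suc (suc m)) =
  Unique.++⁺ (Unique.map⁺ (λ where refl → refl) (stepSequences-unique m))
    (Unique.++⁺ (Unique.map⁺ (λ where refl → refl) (coverPairs-unique (suc m)))
                (Unique.map⁺ (λ where refl → refl) (coverPairs-unique (suc m)))
                U≢D)
    flip≢keep
  where
  K = coverPairs (suc m)
  U≢D : ∀ {p} → ¬ (p ∈ map (keepPair U) K × p ∈ map (keepPair D) K)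
  U≢D (p∈U , p∈D) with ∈-map⁻ (keepPair U) p∈U | ∈-map⁻ (keepPair D) p∈D
  ... | _ , _ , refl | _ , _ , ()
  flip≢keep : ∀ {p} → ¬ (p ∈ map flipPair (stepSequences m) × p ∈ map (keepPair U) K ++ map (keepPair D) K)
  flip≢keep (p∈flips , p∈keeps) with ∈-map⁻ flipPair p∈flips | ∈-++⁻ (map (keepPair U) K) p∈keeps
  ... | _ , _ , refl | inj₁ p∈U with ∈-map⁻ (keepPair U) p∈U
  ...   | _ , _ , ()
  flip≢keep (p∈flips , p∈keeps) | _ , _ , refl | inj₂ p∈D with ∈-map⁻ (keepPair D) p∈D
  ...   | _ , _ , ()

count-coverPairs-zero : ∀ m → count (ups ∘ proj₁) 0 (coverPairs m) ≡ 0
count-coverPairs-zero m =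
  count-none (ups ∘ proj₁) 0 (All.map ↗-ups≢0 (coverPairs-sound m))

-- Deleting the flipped valley leaves one of the C(m , k) words of length m with k
-- up-steps, and the valley can be put back in m + 1 places.
count-coverPairs : ∀ m k → count (ups ∘ proj₁) (suc k) (coverPairs (2 + m)) ≡ suc m * (m C k)
count-coverPairs m k = begin
  count f (suc k) (F ++ map (keepPair U) K ++ map (keepPair D) K)
    ≡⟨ trans (count-++ f (suc k) F _) (cong (_+_ (count f (suc k) F)) (count-++ f (suc k) (map (keepPair U) K) _)) ⟩
  count f (suc k) F + (count f (suc k) (map (keepPair U) K) + count f (suc k) (map (keepPair D) K))
    ≡⟨ cong₂ _+_
         (trans (count-map f (suc k) flipPair ups k (λ _ → suc-⇔) (stepSequences m)) (count-stepSequences m k))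
         (cong₂ _+_ (count-map f (suc k) (keepPair U) f k (λ _ → suc-⇔) K)
                    (count-map f (suc k) (keepPair D) f (suc k) (λ _ → ⇔-id _) K)) ⟩
  m C k + (count f k K + count f (suc k) K)
    ≡⟨ recurrence m k ⟩
  suc m * (m C k) ∎
  where
  open ≡-Reasoning
  f : Pair l → ℕ
  f = ups ∘ proj₁
  F = map flipPair (stepSequences m)
  K = coverPairs (suc m)
  recurrence : ∀ m k →
    m C k + (count f k (coverPairs (suc m)) + count f (suc k) (coverPairs (suc m)))
      ≡ suc m * (m C k)
  recurrence zero k = refl
  recurrence (suc m) zero = begin
    1 + (count f 0 (coverPairs (2 + m)) + count f 1 (coverPairs (2 + m)))
      ≡⟨ cong suc (cong₂ _+_ (count-coverPairs-zero (2 + m)) (count-coverPairs m 0)) ⟩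
    (2 + m) * 1 ∎
  recurrence (suc m) (suc k) = begin
    suc m C suc k + (count f (suc k) (coverPairs (2 + m)) + count f (2 + k) (coverPairs (2 + m)))
      ≡⟨ cong (_+_ (suc m C suc k)) (cong₂ _+_ (count-coverPairs m k) (count-coverPairs m (suc k))) ⟩
    suc m C suc k + (suc m * (m C k) + suc m * (m C suc k))
      ≡⟨ cong (_+_ (suc m C suc k)) (sym (ℕ.*-distribˡ-+ (suc m) (m C k) (m C suc k))) ⟩
    suc m C suc k + suc m * (m C k + m C suc k)
      -- Pascal's rule merges the flips behind a common first step into `suc m` copies of
      -- `suc m C suc k`; the front flips supply one more.
      ≡⟨ cong (λ c → suc m C suc k + suc m * c) (nCk+nC[k+1]≡[n+1]C[k+1] m k) ⟩
    (2 + m) * (suc m C suc k) ∎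

-- Size and number of covers of the Grand Dyck lattice

length-toList : {A : Set} {P : A → Set} {xs : List A} (ps : All P xs) → length (toList ps) ≡ length xs
length-toList []       = refl
length-toList (_ ∷ ps) = cong suc (length-toList ps)

size-GD : ∀ n → FinitePoset.size (GD n) ≡ (2 * n) C n
size-GD n = begin
  length (grandDyckPaths n)
    ≡⟨ length-toList (All.all-filter returnsTo0? S) ⟩
  length (filter returnsTo0? S)
    ≡⟨ cong length (filter-≐ returnsTo0? (λ γ → ups γ ≟ n)
         (Equivalence.to (returns⇔ups {n} _) , Equivalence.from (returns⇔ups {n} _)) S) ⟩
  count ups n S
    ≡⟨ count-stepSequences (2 * n) n ⟩
  (2 * n) C n ∎
  where
  open ≡-Reasoning
  S = stepSequences (2 * n)

unique∧set⇒length≡ : {A : Set} {xs ys : List A} → Unique xs → Unique ys →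
  (∀ {x} → x ∈ xs ⇔ x ∈ ys) → length xs ≡ length ys
unique∧set⇒length≡ u v e = ↭-length (∼bag⇒↭ (unique∧set⇒bag u v e))

-- Forgetting the proofs of return is injective on pairs of paths. The two lists then have no
-- repetitions and, covers being flips, the same members, hence equal length.
ℓ-GD≡count : ∀ n → ℓ (GD n) ≡ count (ups ∘ proj₁) n (coverPairs (2 * n))
ℓ-GD≡count n = trans (sym (length-map words covers))
  (unique∧set⇒length≡
    (Unique.map⁺ words-injective
      (Unique.filter⁺ (λ (γ , δ) → γ ⋖? δ) (Unique.cartesianProduct⁺ unique unique)))
    (Unique.filter⁺ (λ p → ups (proj₁ p) ≟ n) (coverPairs-unique (2 * n)))
    (mk⇔ to from))
  where
  open FinitePoset (GD n) using (_⋖?_; elements; enumerates; unique)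
  covers = filter (λ (γ , δ) → γ ⋖? δ) (cartesianProduct elements elements)
  words : GrandDyckPath n × GrandDyckPath n → Pair (2 * n)
  words ((γ , _) , (δ , _)) = γ , δ
  words-injective : ∀ {p q} → words p ≡ words q → p ≡ q
  words-injective eq = cong₂ _,_ (path-≡ (cong proj₁ eq)) (path-≡ (cong proj₂ eq))
  to : ∀ {p} → p ∈ map words covers → p ∈ filter (λ p → ups (proj₁ p) ≟ n) (coverPairs (2 * n))
  to p∈ with ∈-map⁻ words p∈
  ... | ((γ , γ-returns) , δ) , q∈ , refl = ∈-filter⁺ (λ p → ups (proj₁ p) ≟ n)
    (coverPairs-complete (⋖⇒↗ {n} {γ , γ-returns} {δ}
      (proj₂ (∈-filter⁻ (λ (γ , δ) → γ ⋖? δ) {xs = cartesianProduct elements elements} q∈))))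
    (Equivalence.to (returns⇔ups {n} γ) γ-returns)
  from : ∀ {p} → p ∈ filter (λ p → ups (proj₁ p) ≟ n) (coverPairs (2 * n)) → p ∈ map words covers
  from {γ , δ} p∈ with ∈-filter⁻ (λ p → ups (proj₁ p) ≟ n) p∈
  ... | q∈ , γ-ups = ∈-map⁺ words (∈-filter⁺ (λ (γ , δ) → γ ⋖? δ)
      (∈-cartesianProduct⁺ (enumerates γ′) (enumerates δ′)) (↗⇒⋖ {n} {γ′} {δ′} c))
    where
    c = All.lookup (coverPairs-sound (2 * n)) q∈
    γ′ δ′ : GrandDyckPath n
    γ′ = γ , Equivalence.from (returns⇔ups {n} γ) γ-ups
    δ′ = δ , Equivalence.from (returns⇔ups {n} δ) (trans (sym (↗-ups c)) γ-ups)

-- `2 * suc n` does not reduce to two leading successors, which `coverPairs` needs in order to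
-- unfold.
2*suc : ∀ n → 2 * suc n ≡ 2 + 2 * n
2*suc = solve-∀

ℓ-GD-zero : ℓ (GD 0) ≡ 0
ℓ-GD-zero = ℓ-GD≡count 0

ℓ-GD-suc : ∀ n → ℓ (GD (suc n)) ≡ suc (2 * n) * ((2 * n) C n)
ℓ-GD-suc n = begin
  ℓ (GD (suc n))                                          ≡⟨ ℓ-GD≡count (suc n) ⟩
  count (ups ∘ proj₁) (suc n) (coverPairs (2 * suc n))    ≡⟨ cong (λ m → count (ups ∘ proj₁) (suc n) (coverPairs m)) (2*suc n) ⟩
  count (ups ∘ proj₁) (suc n) (coverPairs (2 + 2 * n))    ≡⟨ count-coverPairs (2 * n) n ⟩
  suc (2 * n) * ((2 * n) C n)                               ∎
  where open ≡-Reasoning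

-- Central binomial coefficients

absorption : ∀ n k → suc k * (suc n C suc k) ≡ suc n * (n C k)
absorption zero    zero    = refl
absorption zero    (suc k) = ℕ.*-zeroʳ (2 + k)
absorption (suc n) zero    = trans (cong (1 *_) (nC1≡n (2 + n))) (lemma n)
  where
  lemma : ∀ n → 1 * (2 + n) ≡ (2 + n) * 1
  lemma = solve-∀
absorption (suc n) (suc k) = begin
  (2 + k) * ((2 + n) C (2 + k))                      ≡⟨ cong ((2 + k) *_) (nCk+nC[k+1]≡[n+1]C[k+1] (suc n) (suc k)) ⟨
  -- One copy of `suc n C suc k` is set aside so that the induction hypothesis fits both remaining
  -- products.
  (2 + k) * (suc n C suc k + suc n C (2 + k))      ≡⟨ lemma k (suc n C suc k) (suc n C (2 + k)) ⟩
  suc n C suc k + (suc k * (suc n C suc k) + (2 + k) * (suc n C (2 + k)))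
    ≡⟨ cong (_+_ (suc n C suc k)) (cong₂ _+_ (absorption n k) (absorption n (suc k))) ⟩
  suc n C suc k + (suc n * (n C k) + suc n * (n C suc k))
    ≡⟨ cong (_+_ (suc n C suc k)) (ℕ.*-distribˡ-+ (suc n) (n C k) (n C suc k)) ⟨
  suc n C suc k + suc n * (n C k + n C suc k)
    ≡⟨ cong (λ c → suc n C suc k + suc n * c) (nCk+nC[k+1]≡[n+1]C[k+1] n k) ⟩
  (2 + n) * (suc n C suc k) ∎
  where
  open ≡-Reasoning
  lemma : ∀ k a b → (2 + k) * (a + b) ≡ a + (suc k * a + (2 + k) * b)
  lemma = solve-∀

-- Two absorptions, with the symmetry of the row `suc (2 * n)` about its middle applied in between.
central-C-suc : ∀ n → suc n * ((2 * suc n) C suc n) ≡ 2 * (suc (2 * n) * ((2 * n) C n))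
central-C-suc n = begin
  suc n * ((2 * suc n) C suc n)            ≡⟨ cong (λ m → suc n * (m C suc n)) (2*suc n) ⟩
  suc n * ((2 + 2 * n) C suc n)            ≡⟨ absorption (suc (2 * n)) n ⟩
  (2 + 2 * n) * (suc (2 * n) C n)          ≡⟨ cong ((2 + 2 * n) *_) symmetric ⟩
  (2 + 2 * n) * (suc (2 * n) C suc n)      ≡⟨ lemma n (suc (2 * n) C suc n) ⟩
  2 * (suc n * (suc (2 * n) C suc n))      ≡⟨ cong (2 *_) (absorption (2 * n) n) ⟩
  2 * (suc (2 * n) * ((2 * n) C n))        ∎
  where
  open ≡-Reasoning
  lemma : ∀ n c → (2 + 2 * n) * c ≡ 2 * (suc n * c)
  lemma = solve-∀
  split : ∀ n → suc (2 * n) ≡ n + suc n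
  split = solve-∀
  symmetric : suc (2 * n) C n ≡ suc (2 * n) C suc n
  symmetric = subst (λ m → m C n ≡ m C suc n) (sym (split n))
    (trans (nCk≡nC[n∸k] (ℕ.m≤m+n n (suc n))) (cong ((n + suc n) C_) (ℕ.m+n∸m≡n n (suc n))))

2*ℓ-GD : ∀ n → 2 * ℓ (GD n) ≡ n * ((2 * n) C n)
2*ℓ-GD zero    = cong (2 *_) ℓ-GD-zero
2*ℓ-GD (suc n) = trans (cong (2 *_) (ℓ-GD-suc n)) (sym (central-C-suc n))

-- Arithmetic of fractions

fromℚᵘ-+ : ∀ p q → ℚ.fromℚᵘ p ℚ.+ ℚ.fromℚᵘ q ≡ ℚ.fromℚᵘ (p ℚᵘ.+ q)
fromℚᵘ-+ p q = ℚ.toℚᵘ-injective (begin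
  ℚ.toℚᵘ (ℚ.fromℚᵘ p ℚ.+ ℚ.fromℚᵘ q)             ≈⟨ ℚ.toℚᵘ-homo-+ (ℚ.fromℚᵘ p) (ℚ.fromℚᵘ q) ⟩
  ℚ.toℚᵘ (ℚ.fromℚᵘ p) ℚᵘ.+ ℚ.toℚᵘ (ℚ.fromℚᵘ q)   ≈⟨ ℚᵘ.+-cong (ℚ.toℚᵘ-fromℚᵘ p) (ℚ.toℚᵘ-fromℚᵘ q) ⟩
  p ℚᵘ.+ q                                       ≈⟨ ℚ.toℚᵘ-fromℚᵘ (p ℚᵘ.+ q) ⟨
  ℚ.toℚᵘ (ℚ.fromℚᵘ (p ℚᵘ.+ q))                   ∎)
  where open ℚᵘ.≃-Reasoning

fromℚᵘ-* : ∀ p q → ℚ.fromℚᵘ p ℚ.* ℚ.fromℚᵘ q ≡ ℚ.fromℚᵘ (p ℚᵘ.* q)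
fromℚᵘ-* p q = ℚ.toℚᵘ-injective (begin
  ℚ.toℚᵘ (ℚ.fromℚᵘ p ℚ.* ℚ.fromℚᵘ q)             ≈⟨ ℚ.toℚᵘ-homo-* (ℚ.fromℚᵘ p) (ℚ.fromℚᵘ q) ⟩
  ℚ.toℚᵘ (ℚ.fromℚᵘ p) ℚᵘ.* ℚ.toℚᵘ (ℚ.fromℚᵘ q)   ≈⟨ ℚᵘ.*-cong (ℚ.toℚᵘ-fromℚᵘ p) (ℚ.toℚᵘ-fromℚᵘ q) ⟩
  p ℚᵘ.* q                                       ≈⟨ ℚ.toℚᵘ-fromℚᵘ (p ℚᵘ.* q) ⟨
  ℚ.toℚᵘ (ℚ.fromℚᵘ (p ℚᵘ.* q))                   ∎)
  where open ℚᵘ.≃-Reasoning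

-- A fraction is normalised by a gcd that is stuck on variables, so equality is shown among
-- unnormalised rationals, where it means cross-multiplication.
/-cross : ∀ a b m n .{{_ : NonZero m}} .{{_ : NonZero n}} →
  a ℤ.* + n ≡ b ℤ.* + m → a / m ≡ b / n
/-cross a b (suc m) (suc n) eq = ℚ.fromℚᵘ-cong {mkℚᵘ a m} {mkℚᵘ b n} (ℚᵘ.*≡* eq)

ι : ℕ → ℚ
ι n = + n / 1

ι-+ : ∀ m n → ι m ℚ.+ ι n ≡ ι (m + n)
ι-+ m n = trans (fromℚᵘ-+ (mkℚᵘ (+ m) 0) (mkℚᵘ (+ n) 0))
  (cong (_/ 1) (trans (cong₂ ℤ._+_ (ℤ.*-identityʳ (+ m)) (ℤ.*-identityʳ (+ n))) (sym (ℤ.pos-+ m n))))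

ι-* : ∀ m n → ι m ℚ.* ι n ≡ ι (m * n)
ι-* m n = trans (fromℚᵘ-* (mkℚᵘ (+ m) 0) (mkℚᵘ (+ n) 0)) (cong (_/ 1) (sym (ℤ.pos-* m n)))

1/suc*suc : ∀ n → (+ 1 / suc n) ℚ.* ι (suc n) ≡ 1ℚ
1/suc*suc n = trans (fromℚᵘ-* (mkℚᵘ (+ 1) n) (mkℚᵘ (+ suc n) 0))
  (/-cross (+ 1 ℤ.* + suc n) (+ 1) (suc n * 1) 1 (trans (ℤ.*-identityʳ _)
    (cong (λ m → + 1 ℤ.* + m) (sym (ℕ.*-identityʳ (suc n))))))

ι-suc-nonZeroDivisor : ∀ n {q} → ι (suc n) ℚ.* q ≡ 0ℚ → q ≡ 0ℚ
ι-suc-nonZeroDivisor n {q} eq = begin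
  q                                         ≡⟨ ℚ.*-identityˡ q ⟨
  1ℚ ℚ.* q                                  ≡⟨ cong (ℚ._* q) (1/suc*suc n) ⟨
  (+ 1 / suc n) ℚ.* ι (suc n) ℚ.* q         ≡⟨ ℚ.*-assoc (+ 1 / suc n) (ι (suc n)) q ⟩
  (+ 1 / suc n) ℚ.* (ι (suc n) ℚ.* q)       ≡⟨ cong ((+ 1 / suc n) ℚ.*_) eq ⟩
  (+ 1 / suc n) ℚ.* 0ℚ                      ≡⟨ ℚ.*-zeroʳ (+ 1 / suc n) ⟩
  0ℚ                                        ∎
  where open ≡-Reasoning

-- Sums and power series

-- The bound `k ≤ n` is supplied because `n ∸ k` in a product of series is a true difference only
-- there.
sumUpTo-cong : ∀ {f g} n → (∀ k → k ≤ n → f k ≡ g k) → sumUpTo f n ≡ sumUpTo g n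
sumUpTo-cong zero    eq = eq 0 z≤n
sumUpTo-cong (suc n) eq =
  cong₂ ℚ._+_ (sumUpTo-cong n (λ k k≤n → eq k (ℕ.m≤n⇒m≤1+n k≤n))) (eq (suc n) ℕ.≤-refl)

sumUpTo-zero : ∀ {f} n → (∀ k → f k ≡ 0ℚ) → sumUpTo f n ≡ 0ℚ
sumUpTo-zero zero    eq = eq 0
sumUpTo-zero (suc n) eq = cong₂ ℚ._+_ (sumUpTo-zero n eq) (eq (suc n))

sumUpTo-head : ∀ f n → sumUpTo f (suc n) ≡ f 0 ℚ.+ sumUpTo (f ∘ suc) n
sumUpTo-head f zero    = refl
sumUpTo-head f (suc n) = trans (cong (ℚ._+ f (2 + n)) (sumUpTo-head f n))
  (ℚ.+-assoc (f 0) (sumUpTo (f ∘ suc) n) (f (2 + n)))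

sumUpTo-+ : ∀ f g n → sumUpTo (λ k → f k ℚ.+ g k) n ≡ sumUpTo f n ℚ.+ sumUpTo g n
sumUpTo-+ f g zero    = refl
sumUpTo-+ f g (suc n) = trans (cong (ℚ._+ (f (suc n) ℚ.+ g (suc n))) (sumUpTo-+ f g n))
  (solve 4 (λ a b c d → (a :+ b) :+ (c :+ d) := (a :+ c) :+ (b :+ d)) refl
    (sumUpTo f n) (sumUpTo g n) (f (suc n)) (g (suc n)))

sumUpTo-*ˡ : ∀ c f n → sumUpTo (λ k → c ℚ.* f k) n ≡ c ℚ.* sumUpTo f n
sumUpTo-*ˡ c f zero    = refl
sumUpTo-*ˡ c f (suc n) = trans (cong (ℚ._+ c ℚ.* f (suc n)) (sumUpTo-*ˡ c f n))
  (sym (ℚ.*-distribˡ-+ c (sumUpTo f n) (f (suc n))))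

tail : Series → Series
tail f = f ∘ suc

*ₛ-suc : ∀ f g n → (f *ₛ g) (suc n) ≡ f 0 ℚ.* g (suc n) ℚ.+ (tail f *ₛ g) n
*ₛ-suc f g n = sumUpTo-head (λ k → f k ℚ.* g (suc n ∸ k)) n

*ₛ-suc-zeroˡ : ∀ f g n → f 0 ≡ 0ℚ → (f *ₛ g) (suc n) ≡ (tail f *ₛ g) n
*ₛ-suc-zeroˡ f g n f₀≡0 = begin
  (f *ₛ g) (suc n)                             ≡⟨ *ₛ-suc f g n ⟩
  f 0 ℚ.* g (suc n) ℚ.+ (tail f *ₛ g) n        ≡⟨ cong (λ q → q ℚ.* g (suc n) ℚ.+ (tail f *ₛ g) n) f₀≡0 ⟩
  0ℚ ℚ.* g (suc n) ℚ.+ (tail f *ₛ g) n         ≡⟨ cong (ℚ._+ (tail f *ₛ g) n) (ℚ.*-zeroˡ (g (suc n))) ⟩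
  0ℚ ℚ.+ (tail f *ₛ g) n                       ≡⟨ ℚ.+-identityˡ _ ⟩
  (tail f *ₛ g) n                              ∎
  where open ≡-Reasoning

*ₛ-suc-zeroʳ : ∀ f g n → g 0 ≡ 0ℚ → (f *ₛ g) (suc n) ≡ (f *ₛ tail g) n
*ₛ-suc-zeroʳ f g n g₀≡0 = begin
  (f *ₛ g) (suc n)
    ≡⟨ cong₂ ℚ._+_
         (sumUpTo-cong n (λ k k≤n → cong (λ m → f k ℚ.* g m) (ℕ.+-∸-assoc 1 k≤n)))
         (trans (cong (λ m → f (suc n) ℚ.* g m) (ℕ.n∸n≡0 n))
           (trans (cong (f (suc n) ℚ.*_) g₀≡0) (ℚ.*-zeroʳ (f (suc n))))) ⟩
  (f *ₛ tail g) n ℚ.+ 0ℚ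
    ≡⟨ ℚ.+-identityʳ _ ⟩
  (f *ₛ tail g) n ∎
  where open ≡-Reasoning

-- Long division first produces `q 0`; the shifted remainder is then `tail q *ₛ g`, so the claim
-- recurs with `tail q`.
÷ₛ-unique : ∀ f g q .{{_ : ℚ.NonZero (g 0)}} → f ≗ₛ q *ₛ g → f ÷ₛ g ≗ₛ q
÷ₛ-leading : ∀ f g q .{{_ : ℚ.NonZero (g 0)}} → f ≗ₛ q *ₛ g → f 0 ℚ.÷ g 0 ≡ q 0

÷ₛ-leading f g q eq = begin
  f 0 ℚ.* ℚ.1/ g 0             ≡⟨ cong (ℚ._* ℚ.1/ g 0) (eq 0) ⟩
  q 0 ℚ.* g 0 ℚ.* ℚ.1/ g 0     ≡⟨ ℚ.*-assoc (q 0) (g 0) (ℚ.1/ g 0) ⟩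
  q 0 ℚ.* (g 0 ℚ.* ℚ.1/ g 0)   ≡⟨ cong (q 0 ℚ.*_) (ℚ.*-inverseʳ (g 0)) ⟩
  q 0 ℚ.* 1ℚ                   ≡⟨ ℚ.*-identityʳ (q 0) ⟩
  q 0                          ∎
  where open ≡-Reasoning

÷ₛ-unique f g q eq zero    = ÷ₛ-leading f g q eq
÷ₛ-unique f g q eq (suc n) = ÷ₛ-unique _ g (tail q) remainder n
  where
  open ≡-Reasoning
  remainder : ∀ m → f (suc m) ℚ.- (f 0 ℚ.÷ g 0) ℚ.* g (suc m) ≡ (tail q *ₛ g) m
  remainder m = begin
    f (suc m) ℚ.- (f 0 ℚ.÷ g 0) ℚ.* g (suc m)
      ≡⟨ cong₂ (λ a b → a ℚ.- b ℚ.* g (suc m)) (trans (eq (suc m)) (*ₛ-suc q g m)) (÷ₛ-leading f g q eq) ⟩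
    (q 0 ℚ.* g (suc m) ℚ.+ (tail q *ₛ g) m) ℚ.- q 0 ℚ.* g (suc m)
      ≡⟨ solve 2 (λ a b → (a :+ b) :- a := b) refl (q 0 ℚ.* g (suc m)) ((tail q *ₛ g) m) ⟩
    (tail q *ₛ g) m ∎

-- First-order differential equations for series

θ : Series → Series
θ f n = ι n ℚ.* f n

-- `θ` is x d/dx, which preserves degrees: in each term of the product the weight `n` splits as `k`
-- plus `n ∸ k`.
θ-leibniz : ∀ f g n → θ (f *ₛ g) n ≡ (θ f *ₛ g) n ℚ.+ (f *ₛ θ g) n
θ-leibniz f g n = begin
  ι n ℚ.* (f *ₛ g) n
    ≡⟨ sumUpTo-*ˡ (ι n) (λ k → f k ℚ.* g (n ∸ k)) n ⟨
  sumUpTo (λ k → ι n ℚ.* (f k ℚ.* g (n ∸ k))) n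
    ≡⟨ sumUpTo-cong n (λ k k≤n → trans
         (cong (ℚ._* (f k ℚ.* g (n ∸ k))) (trans (cong ι (sym (ℕ.m+[n∸m]≡n k≤n))) (sym (ι-+ k (n ∸ k)))))
         (solve 4 (λ a b c d → (a :+ b) :* (c :* d) := (a :* c) :* d :+ c :* (b :* d)) refl
           (ι k) (ι (n ∸ k)) (f k) (g (n ∸ k)))) ⟩
  sumUpTo (λ k → θ f k ℚ.* g (n ∸ k) ℚ.+ f k ℚ.* θ g (n ∸ k)) n
    ≡⟨ sumUpTo-+ (λ k → θ f k ℚ.* g (n ∸ k)) (λ k → f k ℚ.* θ g (n ∸ k)) n ⟩
  (θ f *ₛ g) n ℚ.+ (f *ₛ θ g) n ∎
  where open ≡-Reasoning

-- Coefficientwise form of (1 - c x) f′ = a f.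
FirstOrder : ℚ → ℚ → Series → Set
FirstOrder c a f = ∀ n → θ f (suc n) ≡ (c ℚ.* ι n ℚ.+ a) ℚ.* f n

-- By the product rule, (1 - c x)(f g)′ = a f g + f b g.
*ₛ-firstOrder : ∀ c a b f g → FirstOrder c a f → FirstOrder c b g → FirstOrder c (a ℚ.+ b) (f *ₛ g)
*ₛ-firstOrder c a b f g ef eg n = begin
  θ (f *ₛ g) (suc n)
    ≡⟨ θ-leibniz f g (suc n) ⟩
  (θ f *ₛ g) (suc n) ℚ.+ (f *ₛ θ g) (suc n)
    -- `θ f` and `θ g` have no constant term, so a factor x can be cancelled.
    ≡⟨ cong₂ ℚ._+_ (*ₛ-suc-zeroˡ (θ f) g n (ℚ.*-zeroˡ (f 0))) (*ₛ-suc-zeroʳ f (θ g) n (ℚ.*-zeroˡ (g 0))) ⟩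
  (tail (θ f) *ₛ g) n ℚ.+ (f *ₛ tail (θ g)) n
    ≡⟨ sumUpTo-+ _ _ n ⟨
  sumUpTo (λ k → θ f (suc k) ℚ.* g (n ∸ k) ℚ.+ f k ℚ.* θ g (suc (n ∸ k))) n
    ≡⟨ sumUpTo-cong n term ⟩
  sumUpTo (λ k → (c ℚ.* ι n ℚ.+ (a ℚ.+ b)) ℚ.* (f k ℚ.* g (n ∸ k))) n
    ≡⟨ sumUpTo-*ˡ (c ℚ.* ι n ℚ.+ (a ℚ.+ b)) (λ k → f k ℚ.* g (n ∸ k)) n ⟩
  (c ℚ.* ι n ℚ.+ (a ℚ.+ b)) ℚ.* (f *ₛ g) n ∎
  where
  open ≡-Reasoning
  term : ∀ k → k ≤ n → θ f (suc k) ℚ.* g (n ∸ k) ℚ.+ f k ℚ.* θ g (suc (n ∸ k))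
                       ≡ (c ℚ.* ι n ℚ.+ (a ℚ.+ b)) ℚ.* (f k ℚ.* g (n ∸ k))
  term k k≤n = begin
    θ f (suc k) ℚ.* g (n ∸ k) ℚ.+ f k ℚ.* θ g (suc (n ∸ k))
      ≡⟨ cong₂ (λ u v → u ℚ.* g (n ∸ k) ℚ.+ f k ℚ.* v) (ef k) (eg (n ∸ k)) ⟩
    (c ℚ.* ι k ℚ.+ a) ℚ.* f k ℚ.* g (n ∸ k) ℚ.+ f k ℚ.* ((c ℚ.* ι (n ∸ k) ℚ.+ b) ℚ.* g (n ∸ k))
      ≡⟨ solve 7 (λ c a b x y u v → (c :* x :+ a) :* u :* v :+ u :* ((c :* y :+ b) :* v)
                                  := (c :* (x :+ y) :+ (a :+ b)) :* (u :* v)) refl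
           c a b (ι k) (ι (n ∸ k)) (f k) (g (n ∸ k)) ⟩
    (c ℚ.* (ι k ℚ.+ ι (n ∸ k)) ℚ.+ (a ℚ.+ b)) ℚ.* (f k ℚ.* g (n ∸ k))
      ≡⟨ cong (λ x → (c ℚ.* x ℚ.+ (a ℚ.+ b)) ℚ.* (f k ℚ.* g (n ∸ k)))
           (trans (ι-+ k (n ∸ k)) (cong ι (ℕ.m+[n∸m]≡n k≤n))) ⟩
    (c ℚ.* ι n ℚ.+ (a ℚ.+ b)) ℚ.* (f k ℚ.* g (n ∸ k)) ∎

-- The recurrence starts with the factor `c ℚ.* 0ℚ ℚ.+ 0ℚ`, which kills the coefficient of x; from
-- there each zero forces the next.
firstOrder-zero⇒constant : ∀ c f → FirstOrder c 0ℚ f → ∀ n → f (suc n) ≡ 0ℚ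
firstOrder-zero⇒constant c f e zero    = ι-suc-nonZeroDivisor 0 (begin
  θ f 1                             ≡⟨ e 0 ⟩
  (c ℚ.* 0ℚ ℚ.+ 0ℚ) ℚ.* f 0         ≡⟨ cong (λ x → (x ℚ.+ 0ℚ) ℚ.* f 0) (ℚ.*-zeroʳ c) ⟩
  0ℚ ℚ.* f 0                        ≡⟨ ℚ.*-zeroˡ (f 0) ⟩
  0ℚ                                ∎)
  where open ≡-Reasoning
firstOrder-zero⇒constant c f e (suc n) = ι-suc-nonZeroDivisor (suc n) (begin
  θ f (2 + n)                              ≡⟨ e (suc n) ⟩
  (c ℚ.* ι (suc n) ℚ.+ 0ℚ) ℚ.* f (suc n)     ≡⟨ cong ((c ℚ.* ι (suc n) ℚ.+ 0ℚ) ℚ.*_) (firstOrder-zero⇒constant c f e n) ⟩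
  (c ℚ.* ι (suc n) ℚ.+ 0ℚ) ℚ.* 0ℚ            ≡⟨ ℚ.*-zeroʳ (c ℚ.* ι (suc n) ℚ.+ 0ℚ) ⟩
  0ℚ                                         ∎)
  where open ≡-Reasoning

-- The series (1 - 4x)^(3/2)

infixr 8 _^_
_^_ : ℚ → ℕ → ℚ
c ^ zero  = 1ℚ
c ^ suc n = c ℚ.* c ^ n

*ₛ-monomial : ∀ h f n → h 0 ≡ 0ℚ → (∀ k → h (2 + k) ≡ 0ℚ) → (h *ₛ f) (suc n) ≡ h 1 ℚ.* f n
*ₛ-monomial h f n h₀ h₂ = trans (*ₛ-suc-zeroˡ h f n h₀) (head n)
  where
  head : ∀ n → (tail h *ₛ f) n ≡ h 1 ℚ.* f n
  head zero    = refl
  head (suc n) = begin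
    (tail h *ₛ f) (suc n)                                 ≡⟨ *ₛ-suc (tail h) f n ⟩
    h 1 ℚ.* f (suc n) ℚ.+ (tail (tail h) *ₛ f) n
      ≡⟨ cong (h 1 ℚ.* f (suc n) ℚ.+_) (sumUpTo-zero n (λ k →
           trans (cong (ℚ._* f (n ∸ k)) (h₂ k)) (ℚ.*-zeroˡ (f (n ∸ k))))) ⟩
    h 1 ℚ.* f (suc n) ℚ.+ 0ℚ                              ≡⟨ ℚ.+-identityʳ _ ⟩
    h 1 ℚ.* f (suc n)                                     ∎
    where open ≡-Reasoning

-- Since `h` is a multiple of x, only its `n`-th power reaches degree `n`. The weights `b` are
-- arbitrary because the induction shifts them and absorbs a factor `h 1`.
sum-powers-monomial : ∀ h → h 0 ≡ 0ℚ → (∀ k → h (2 + k) ≡ 0ℚ) → ∀ b n →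
  sumUpTo (λ k → b k ℚ.* (h ^ₛ k) n) n ≡ b n ℚ.* h 1 ^ n
sum-powers-monomial h h₀ h₂ b zero    = refl
sum-powers-monomial h h₀ h₂ b (suc n) = begin
  sumUpTo (λ k → b k ℚ.* (h ^ₛ k) (suc n)) (suc n)
    ≡⟨ sumUpTo-head (λ k → b k ℚ.* (h ^ₛ k) (suc n)) n ⟩
  b 0 ℚ.* 0ℚ ℚ.+ sumUpTo (λ k → b (suc k) ℚ.* (h *ₛ h ^ₛ k) (suc n)) n
    ≡⟨ cong₂ ℚ._+_ (ℚ.*-zeroʳ (b 0)) (sumUpTo-cong n (λ k _ → trans
         (cong (b (suc k) ℚ.*_) (*ₛ-monomial h (h ^ₛ k) n h₀ h₂))
         (sym (ℚ.*-assoc (b (suc k)) (h 1) ((h ^ₛ k) n))))) ⟩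
  0ℚ ℚ.+ sumUpTo (λ k → b (suc k) ℚ.* h 1 ℚ.* (h ^ₛ k) n) n
    ≡⟨ ℚ.+-identityˡ _ ⟩
  sumUpTo (λ k → b (suc k) ℚ.* h 1 ℚ.* (h ^ₛ k) n) n
    ≡⟨ sum-powers-monomial h h₀ h₂ (λ k → b (suc k) ℚ.* h 1) n ⟩
  b (suc n) ℚ.* h 1 ℚ.* h 1 ^ n
    ≡⟨ ℚ.*-assoc (b (suc n)) (h 1) (h 1 ^ n) ⟩
  b (suc n) ℚ.* h 1 ^ suc n ∎
  where open ≡-Reasoning

[1-4x]^3/2 : Series
[1-4x]^3/2 = power (1ₛ -ₛ (+ 4 / 1) • X) refl (+ 3 / 2)

-4ℚ : ℚ
-4ℚ = -[1+ 3 ] / 1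

[1-4x]^3/2-coefficient : ∀ n → [1-4x]^3/2 n ≡ binomial (+ 3 / 2) n ℚ.* -4ℚ ^ n
[1-4x]^3/2-coefficient n =
  sum-powers-monomial ((1ₛ -ₛ (+ 4 / 1) • X) -ₛ 1ₛ) refl (λ _ → refl) (binomial (+ 3 / 2)) n

-- The ratio of consecutive binomial coefficients is (3/2 - n)/(n + 1), and -4 (3/2 - n) = 4n - 6.
[1-4x]^3/2-firstOrder : FirstOrder (ι 4) (-[1+ 5 ] / 1) [1-4x]^3/2
[1-4x]^3/2-firstOrder n = begin
  ι (suc n) ℚ.* [1-4x]^3/2 (suc n)
    ≡⟨ cong (ι (suc n) ℚ.*_) ([1-4x]^3/2-coefficient (suc n)) ⟩
  ι (suc n) ℚ.* (β ℚ.* (α ℚ.- ι n) ℚ.* r ℚ.* (-4ℚ ℚ.* -4ℚ ^ n))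
    ≡⟨ solve 6 (λ s β d r c p → s :* (β :* d :* r :* (c :* p)) := (r :* s) :* (d :* c :* (β :* p))) refl
         (ι (suc n)) β (α ℚ.- ι n) r -4ℚ (-4ℚ ^ n) ⟩
  (r ℚ.* ι (suc n)) ℚ.* ((α ℚ.- ι n) ℚ.* -4ℚ ℚ.* (β ℚ.* -4ℚ ^ n))
    ≡⟨ cong₂ (λ u v → u ℚ.* ((α ℚ.- ι n) ℚ.* -4ℚ ℚ.* v)) (1/suc*suc n) (sym ([1-4x]^3/2-coefficient n)) ⟩
  1ℚ ℚ.* ((α ℚ.- ι n) ℚ.* -4ℚ ℚ.* [1-4x]^3/2 n)
    ≡⟨ ℚ.*-identityˡ _ ⟩
  (α ℚ.- ι n) ℚ.* -4ℚ ℚ.* [1-4x]^3/2 n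
    ≡⟨ cong (ℚ._* [1-4x]^3/2 n)
         (solve 1 (λ x → (con α :- x) :* con -4ℚ := con (ι 4) :* x :+ con (-[1+ 5 ] / 1)) refl (ι n)) ⟩
  (ι 4 ℚ.* ι n ℚ.+ -[1+ 5 ] / 1) ℚ.* [1-4x]^3/2 n ∎
  where
  open ≡-Reasoning
  α = + 3 / 2
  β = binomial α n
  r = + 1 / suc n

-- The edge generating series

edges : Series
edges n = ι (ℓ (GD n))

-- The closed form and the recurrence of the central binomial coefficients give consecutive edge
-- numbers the ratio (4n + 6)/(n + 1).
tail-edges-firstOrder : FirstOrder (ι 4) (ι 6) (tail edges)
tail-edges-firstOrder n = begin
  ι (suc n) ℚ.* ι (ℓ (GD (2 + n)))                 ≡⟨ ι-* (suc n) (ℓ (GD (2 + n))) ⟩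
  ι (suc n * ℓ (GD (2 + n)))                       ≡⟨ cong ι recurrence ⟩
  ι ((4 * n + 6) * ℓ (GD (suc n)))                 ≡⟨ ι-* (4 * n + 6) (ℓ (GD (suc n))) ⟨
  ι (4 * n + 6) ℚ.* ι (ℓ (GD (suc n)))
    ≡⟨ cong (ℚ._* ι (ℓ (GD (suc n)))) (trans (cong (ℚ._+ ι 6) (ι-* 4 n)) (ι-+ (4 * n) 6)) ⟨
  (ι 4 ℚ.* ι n ℚ.+ ι 6) ℚ.* ι (ℓ (GD (suc n)))     ∎
  where
  open ≡-Reasoning
  lemma₁ : ∀ n c → suc n * (suc (2 * suc n) * c) ≡ suc (2 * suc n) * (suc n * c)
  lemma₁ = solve-∀
  lemma₂ : ∀ n c → suc (2 * suc n) * (2 * c) ≡ (4 * n + 6) * c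
  lemma₂ = solve-∀
  recurrence : suc n * ℓ (GD (2 + n)) ≡ (4 * n + 6) * ℓ (GD (suc n))
  recurrence = begin
    suc n * ℓ (GD (2 + n))                                   ≡⟨ cong (suc n *_) (ℓ-GD-suc (suc n)) ⟩
    suc n * (suc (2 * suc n) * ((2 * suc n) C suc n))        ≡⟨ lemma₁ n ((2 * suc n) C suc n) ⟩
    suc (2 * suc n) * (suc n * ((2 * suc n) C suc n))        ≡⟨ cong (suc (2 * suc n) *_) (central-C-suc n) ⟩
    suc (2 * suc n) * (2 * (suc (2 * n) * ((2 * n) C n)))    ≡⟨ lemma₂ n (suc (2 * n) * ((2 * n) C n)) ⟩
    (4 * n + 6) * (suc (2 * n) * ((2 * n) C n))              ≡⟨ cong ((4 * n + 6) *_) (ℓ-GD-suc n) ⟨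
    (4 * n + 6) * ℓ (GD (suc n))                             ∎

-- The parameters 6 and -6 cancel, so the product is constant; its constant term is `ℓ (GD 1)`,
-- which is 1.
tail-edges*[1-4x]^3/2≡1 : tail edges *ₛ [1-4x]^3/2 ≗ₛ 1ₛ
tail-edges*[1-4x]^3/2≡1 zero    = cong (λ e → ι e ℚ.* [1-4x]^3/2 0) (ℓ-GD-suc 0)
tail-edges*[1-4x]^3/2≡1 (suc n) = firstOrder-zero⇒constant (ι 4) (tail edges *ₛ [1-4x]^3/2)
  (*ₛ-firstOrder (ι 4) (ι 6) (-[1+ 5 ] / 1) (tail edges) [1-4x]^3/2
    tail-edges-firstOrder [1-4x]^3/2-firstOrder) n

X≡edges*[1-4x]^3/2 : X ≗ₛ edges *ₛ [1-4x]^3/2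
X≡edges*[1-4x]^3/2 zero    = sym (cong (λ e → ι e ℚ.* [1-4x]^3/2 0) ℓ-GD-zero)
X≡edges*[1-4x]^3/2 (suc n) = sym (trans
  (*ₛ-suc-zeroˡ edges [1-4x]^3/2 n (cong ι ℓ-GD-zero)) (tail-edges*[1-4x]^3/2≡1 n))

mainTheorem5 : ((λ n → + ℓ (GD n) / 1) ≗ₛ X ÷ₛ power (1ₛ -ₛ (+ 4 / 1) • X) refl (+ 3 / 2))
    × (∀ n → + ℓ (GD n) / 1 ≡ (+ ((2 * n) C n) / 1) ℚ.* (+ n / 2))
    × (∀ n → i (GD n) {{GD-nonEmpty n}} ≡ + n / 2)
mainTheorem5 =
    (λ n → sym (÷ₛ-unique X [1-4x]^3/2 edges X≡edges*[1-4x]^3/2 n))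
  -- Both remaining claims are `2*ℓ-GD` with denominators cleared; the last one also uses that the
  -- lattice has C(2n , n) elements.
  , (λ n → trans (/-cross (+ ℓ (GD n)) (+ ((2 * n) C n) ℤ.* + n) 1 2 (number n))
             (sym (fromℚᵘ-* (mkℚᵘ (+ ((2 * n) C n)) 0) (mkℚᵘ (+ n) 1))))
  , (λ n → /-cross (+ ℓ (GD n)) (+ n) (FinitePoset.size (GD n)) 2 {{GD-nonEmpty n}} (index n))
  where
  open ≡-Reasoning
  number : ∀ n → + ℓ (GD n) ℤ.* + 2 ≡ + ((2 * n) C n) ℤ.* + n ℤ.* + 1
  number n = begin
    + ℓ (GD n) ℤ.* + 2               ≡⟨ ℤ.pos-* (ℓ (GD n)) 2 ⟨
    + (ℓ (GD n) * 2)                 ≡⟨ cong +_ (ℕ.*-comm (ℓ (GD n)) 2) ⟩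
    + (2 * ℓ (GD n))                 ≡⟨ cong +_ (trans (2*ℓ-GD n) (ℕ.*-comm n ((2 * n) C n))) ⟩
    + (((2 * n) C n) * n)             ≡⟨ ℤ.pos-* ((2 * n) C n) n ⟩
    + ((2 * n) C n) ℤ.* + n          ≡⟨ ℤ.*-identityʳ _ ⟨
    + ((2 * n) C n) ℤ.* + n ℤ.* + 1  ∎
  index : ∀ n → + ℓ (GD n) ℤ.* + 2 ≡ + n ℤ.* + FinitePoset.size (GD n)
  index n = begin
    + ℓ (GD n) ℤ.* + 2                   ≡⟨ number n ⟩
    + ((2 * n) C n) ℤ.* + n ℤ.* + 1      ≡⟨ ℤ.*-identityʳ _ ⟩
    + ((2 * n) C n) ℤ.* + n              ≡⟨ ℤ.*-comm (+ ((2 * n) C n)) (+ n) ⟩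
    + n ℤ.* + ((2 * n) C n)              ≡⟨ cong (λ s → + n ℤ.* + s) (size-GD n) ⟨
    + n ℤ.* + FinitePoset.size (GD n)    ∎
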